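{- For all sufficiently large $n$, there exists a tree $T$ on $n$ vertices such that, in the cat and mouse game on $T$, for every strategy of the cat the mouse has a sequence of moves for which $\mathrm{rad}_T(M_i) > \sqrt{n}/12$ for every time step $i$. That is, the mouse avoids being localised up to distance $\sqrt{n}/12$ for an infinite period of time.
   Context: The cat and mouse game on a connected graph $G$ of order $n$ is played in discrete time steps $i=1,2,\dots$. The mouse occupies vertices $m_1,m_2,\dots$, where for $i\ge 2$ the vertex $m_i$ lies in the closed neighbourhood of $m_{i-1}$. The cat tests vertices $c_1,c_2,\dots$ of $G$ with no restriction. At the end of each step $i\ge 2$ the cat is told $b_i=1$ if $d(c_i,m_i)\le d(c_{i-1},m_{i-1})$ and $b_i=0$ otherwise, where $d$ is the graph distance. A strategy of the cat is deterministic and fixed in advance: $c_1,c_2$ are fixed vertices and $c_i=f(b_2,\dots,b_{i-1})$ for $i\ge 3$, for some function $f$ from finite $0/1$ strings to $V(G)$. The mouse knows the cat's strategy. $M_i$ is the set of vertices $v$ for which there exist $\tilde m_1,\dots,\tilde m_i$ such that: - $\tilde m_i=v$; - $\tilde m_j$ lies in the closed neighbourhood of $\tilde m_{j-1}$ for $2\le j\le i$; - for each $2\le j\le i$, $d(c_j,\tilde m_j)\le d(c_{j-1},\tilde m_{j-1})$ holds if and only if $b_j=1$. The radius of a vertex set $W$ is $\mathrm{rad}_G(W)=\min_{v\in V(G)}\max_{w\in W} d(v,w)$. The cat localises the mouse up to distance $d$ at time $i$ if $\mathrm{rad}_G(M_i)\le d$. -}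

module Defs where

open import Data.Nat using (ℕ; zero; suc; _+_; _*_; _≤_; _≤ᵇ_)
open import Data.Fin using (Fin)
open import Data.Bool using (Bool; true; false; _∧_; _∨_; T)
open import Data.List using (List; []; _∷_; _++_; [_]; allFin)
open import Data.Bool.ListAction using (any)
open import Data.Sum using (_⊎_)
open import Data.Product using (Σ; _×_; ∃; ∃-syntax)
open import Data.Fin using (_≟_)
open import Relation.Nullary using (¬_)
open import Relation.Nullary.Decidable using (⌊_⌋)
open import Relation.Binary.PropositionalEquality using (_≡_)

record Graph (n : ℕ) : Set where
  field
    adj   : Fin n → Fin n → Bool
    sym   : ∀ u v → adj u v ≡ adj v u
    irrefl : ∀ v → adj v v ≡ false
open Graph public

module _ {n : ℕ} (G : Graph n) where

  reach : ℕ → Fin n → Fin n → Bool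
  reach zero    u v = ⌊ u ≟ v ⌋
  reach (suc k) u v = reach k u v ∨ any (λ w → reach k u w ∧ adj G w v) (allFin n)

  ClosedNbr : Fin n → Fin n → Set
  ClosedNbr u v = (u ≡ v) ⊎ T (adj G u v)

  Connected : Set
  Connected = ∀ u v → T (reach n u v)

  edgeCount : ℕ
  edgeCount = countPairs (allFin n)
    where
      open import Data.Fin using (_<?_)
      countPairs : List (Fin n) → ℕ
      countPairs [] = 0
      countPairs (u ∷ us) = cnt (allFin n) + countPairs us
        where
          cnt : List (Fin n) → ℕ
          cnt [] = 0
          cnt (v ∷ vs) with ⌊ u <? v ⌋ ∧ adj G u v
          ... | true  = suc (cnt vs)
          ... | false = cnt vs

  -- graph distance: least k ≤ n with a walk of length ≤ k (equals d(u,v) when connected)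
  dist : Fin n → Fin n → ℕ
  dist u v = search 0 (suc n)
    where
      search : ℕ → ℕ → ℕ
      search k zero    = k
      search k (suc f) with reach k u v
      ... | true  = k
      ... | false = search (suc k) f

IsTree : {n : ℕ} → Graph n → Set
IsTree {n} G = Connected G × (edgeCount G + 1 ≡ n)

record CatStrategy (n : ℕ) : Set where
  field
    c₁ : Fin n
    c₂ : Fin n
    f  : List Bool → Fin n
open CatStrategy public

-- Time steps are indexed from 0 here: index t corresponds to step i = t + 1.
module Game {n : ℕ} (G : Graph n) (S : CatStrategy n) (m : ℕ → Fin n) where

  mutual
    cat : ℕ → Fin n
    cat zero          = c₁ S
    cat (suc zero)    = c₂ S
    cat (suc (suc t)) = f S (hist (suc t))

    -- hist t = (b_2 , … , b_{t+1})
    hist : ℕ → List Bool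
    hist zero    = []
    hist (suc t) = hist t ++ [ bit (suc t) ]

    bit : ℕ → Bool
    bit zero    = true
    bit (suc t) = dist G (cat (suc t)) (m (suc t)) ≤ᵇ dist G (cat t) (m t)

  M : ℕ → Fin n → Set
  M t v = Σ (ℕ → Fin n) λ m' →
            (m' t ≡ v)
          × (∀ j → suc j ≤ t → ClosedNbr G (m' j) (m' (suc j)))
          × (∀ j → suc j ≤ t →
               (dist G (cat (suc j)) (m' (suc j)) ≤ dist G (cat j) (m' j)
                 → T (bit (suc j)))
             × (T (bit (suc j))
                 → dist G (cat (suc j)) (m' (suc j)) ≤ dist G (cat j) (m' j)))

-- rad_G(W) ≤ √n / 12, i.e. ∃ v ∀ w ∈ W, d(v,w) ≤ √n/12 ⇔ 144·d(v,w)² ≤ n.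
RadAtMostSqrtOver12 : {n : ℕ} → Graph n → (Fin n → Set) → Set
RadAtMostSqrtOver12 {n} G W =
  ∃[ v ] (∀ w → W w → 144 * (dist G v w * dist G v w) ≤ n)

ValidMouse : {n : ℕ} → Graph n → (ℕ → Fin n) → Set
ValidMouse G m = ∀ t → ClosedNbr G (m t) (m (suc t))

{-# OPTIONS --safe #-}
module Submission where

-- The tree is a spider: a root with k legs, k slightly above 3H, each of length at least H + 2, where
-- H > √n / 12. A mouse at height h above the root, on a leg avoiding the cat's last two tests at
-- heights x and then y, moves to height h′ and produces the answer "y + h′ ≤ x + h". Hence all such
-- mice making the same height change produce the same answer. The real mouse plays rounds of one to
-- three steps, each starting and ending at the root, arranged so that in every round the answers it
-- produces are also those of a mouse ("ghost") that ends the round one step higher on any leg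
-- untested in that round:
--   one step,    y ≠ x:                              mouse 0,        ghost +1;
--   two steps,   y = x, then y ≠ x + 1:              mouse +1 −1,    ghost +1 0;
--   three steps, y = x, then y = x + 1, then any y:  mouse +1 0 −1,  ghost +1 +1 −1.
-- So every leg untested during the last 3H steps carries a candidate position of height H. As the cat
-- tests one leg per step, such a leg always exists, even off the leg of any given vertex v, and the
-- candidate on it is at distance at least H from v.

open import Defs hiding (sym)
open import Data.Nat
open import Data.Nat.Properties
open import Data.Nat.DivMod
open import Data.Nat.Divisibility using (divides-refl)
open import Data.Fin as Fin using (Fin; toℕ; zero; suc; fromℕ<)
open import Data.Fin.Properties as Fin using (toℕ-injective; toℕ-fromℕ<; toℕ<n; pigeonhole; ¬∀⟶∃¬; any?)
open import Data.Bool using (Bool; true; false; _∧_; _∨_; T; if_then_else_)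
open import Data.Bool.Properties using (∨-comm; T-∨; T-∧; T-≡; ∧-zeroʳ)
open import Data.List using (List; []; _∷_; _++_; [_]; allFin; tabulate)
open import Data.List.Membership.Propositional using (lose; find)
open import Data.List.Membership.Propositional.Properties using (∈-allFin)
open import Data.List.Relation.Unary.Any.Properties using (any⁺; any⁻)
open import Data.Product using (Σ; ∃; ∃-syntax; _×_; _,_; proj₁; proj₂)
open import Data.Sum using (_⊎_; inj₁; inj₂)
open import Data.Unit using (⊤; tt)
open import Function.Base using (id; _∘_)
open import Function.Bundles using (Equivalence; _⇔_; mk⇔)
open import Function.Properties.Equivalence using () renaming (trans to ⇔-trans)
open import Relation.Nullary using (¬_; Dec; yes; no; contradiction)
open import Relation.Nullary.Decidable using (⌊_⌋; toWitness; fromWitness; _×-dec_)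
open import Relation.Binary.PropositionalEquality using (_≡_; _≢_; refl; sym; trans; cong; cong₂; subst; subst₂; module ≡-Reasoning)
open import Algebra.Properties.CommutativeMonoid.Sum +-0-commutativeMonoid using (sum; ∑-comm; sum-cong-≗; sum-replicate-zero)

-- Usable forms of distance and edge count.

bit→ℕ : Bool → ℕ
bit→ℕ b = if b then 1 else 0

-- The worker functions of `dist` and `edgeCount` are local to their definitions and cannot be named.
-- Here they are solutions of metavariables: the `with`-abstractions in the `-solve` lemmas turn
-- their arguments into distinct variables, so that unification determines them. Passing G, u, v as
-- functions on ⊤ makes `G tt` an expression, as Agda refuses to abstract over a variable of an
-- enclosing clause.
mutual
  searchFrom : ∀ {n} → Graph n → Fin n → Fin n → ℕ → ℕ → Bool → ℕ
  searchFrom = _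

  searchFrom-solve : ∀ {n} (G : ⊤ → Graph (suc n)) (u v : ⊤ → Fin (suc n)) →
    reach (G tt) 0 (u tt) (v tt) ≡ false →
    ∃ λ b → dist (G tt) (u tt) (v tt) ≡ searchFrom (G tt) (u tt) (v tt) 1 n b
  searchFrom-solve {n} G u v eq with reach (G tt) 0 (u tt) (v tt)
  ... | false with reach (G tt) 1 (u tt) (v tt)
  ...   | b with suc n | G tt | u tt | v tt | 1
  ...     | _ | _ | _ | _ | _ = b , refl

module _ {n : ℕ} (G : Graph n) (u v : Fin n) {d : ℕ}
  (reach-d : T (reach G d u v)) (d-least : ∀ j → T (reach G j u v) → d ≤ j) where

  -- Loop invariant of the search: it has not passed d, and the remaining fuel reaches d. The
  -- Boolean is the pending test at k.
  searchFrom-least : ∀ k f b → reach G k u v ≡ b → k ≤ d → d ≤ k + f → searchFrom G u v k f b ≡ d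
  searchFrom-least k f true eq k≤d d≤k+f = ≤-antisym k≤d (d-least k (subst T (sym eq) tt))
  searchFrom-least k f false eq k≤d d≤k+f with ≤∧≢⇒< k≤d (λ { refl → subst T eq reach-d })
  searchFrom-least k zero    false eq k≤d d≤k+f | k<d =
    contradiction k<d (≤⇒≯ (≤-trans d≤k+f (≤-reflexive (+-identityʳ k))))
  searchFrom-least k (suc f) false eq k≤d d≤k+f | k<d =
    searchFrom-least (suc k) f _ refl k<d (subst (d ≤_) (+-suc k f) d≤k+f)

  dist-least : d ≤ n → dist G u v ≡ d
  dist-least d≤n = searchFrom-least 0 n _ refl z≤n d≤n

mutual
  countPairs : ∀ {n} → Graph n → List (Fin n) → ℕ
  countPairs = _

  countRow : ∀ {n} → Graph n → Fin n → List (Fin n) → Fin n → List (Fin n) → Bool → ℕ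
  countRow = _

  countPairs-solve : ∀ {n} (G : Graph n) → edgeCount G ≡ countPairs G (allFin n)
  countPairs-solve {n} G with allFin n
  ... | us = refl

  countRow-solve : ∀ {n} (G : Graph n) u us → ∃ λ x → countPairs G (u ∷ us) ≡ x + countPairs G us
  countRow-solve {n} G u us with allFin n
  ... | [] = 0 , refl
  ... | v ∷ vs with ⌊ u Fin.<? v ⌋ ∧ adj G u v
  ... | b = countRow G u us v vs b , refl

-- Only the recursion equations of `h` enter, so this applies to both of the anonymous counting
-- loops.
sum-tabulate : ∀ {A : Set} (h : List A → ℕ) (f : A → ℕ) →
               h [] ≡ 0 → (∀ x xs → h (x ∷ xs) ≡ f x + h xs) →
               ∀ {m} (g : Fin m → A) → h (tabulate g) ≡ sum (f ∘ g)
sum-tabulate h f h-[] h-∷ {zero}  g = h-[]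
sum-tabulate h f h-[] h-∷ {suc m} g =
  trans (h-∷ _ _) (cong (f (g zero) +_) (sum-tabulate h f h-[] h-∷ (g ∘ suc)))

edgeCount≡∑ : ∀ {n} (G : Graph n) →
              edgeCount G ≡ sum λ u → sum λ v → bit→ℕ (⌊ u Fin.<? v ⌋ ∧ adj G u v)
edgeCount≡∑ {n} G = sum-tabulate (countPairs G) _ refl countPairs-∷ id
  where
  -- The rejecting branch of the test at any vertex is the plain count over the remaining list.
  rowCount : Fin n → List (Fin n) → List (Fin n) → ℕ
  rowCount u us vs = countRow G u us u vs false

  countRow-bit : ∀ u us v vs b → countRow G u us v vs b ≡ bit→ℕ b + rowCount u us vs
  countRow-bit u us v vs true  = refl
  countRow-bit u us v vs false = refl

  countPairs-∷ : ∀ u us → countPairs G (u ∷ us) ≡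
                 sum (λ v → bit→ℕ (⌊ u Fin.<? v ⌋ ∧ adj G u v)) + countPairs G us
  countPairs-∷ u us =
    cong (_+ countPairs G us)
      (sum-tabulate (rowCount u us) _ refl (λ v vs → countRow-bit u us v vs _) id)

-- Walks in a graph and finite sums.

module _ {n : ℕ} (G : Graph n) where

  reach-suc : ∀ j {u v} → T (reach G j u v) → T (reach G (suc j) u v)
  reach-suc j r = Equivalence.from T-∨ (inj₁ r)

  reach-adj : ∀ j {u w v} → T (reach G j u w) → T (adj G w v) → T (reach G (suc j) u v)
  reach-adj j {u} {w} {v} r a =
    Equivalence.from (T-∨ {reach G j u v})
      (inj₂ (any⁺ _ (lose (∈-allFin w) (Equivalence.from T-∧ (r , a)))))

  reach-split : ∀ j {u v} → T (reach G (suc j) u v) →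
                T (reach G j u v) ⊎ ∃ λ w → T (reach G j u w) × T (adj G w v)
  reach-split j {u} {v} r with Equivalence.to (T-∨ {reach G j u v}) r
  ... | inj₁ r′ = inj₁ r′
  ... | inj₂ s with w , _ , p ← find (any⁻ _ (allFin n) s) = inj₂ (w , Equivalence.to T-∧ p)

  reach-mono : ∀ {i j u v} → i ≤′ j → T (reach G i u v) → T (reach G j u v)
  reach-mono ≤′-refl           r = r
  reach-mono (≤′-step {j} i≤j) r = reach-suc j (reach-mono i≤j r)

sum-zero : ∀ {n} (f : Fin n → ℕ) → (∀ i → f i ≡ 0) → sum f ≡ 0
sum-zero {n} f f≡0 = trans (sum-cong-≗ f≡0) (sum-replicate-zero n)

sum-one : ∀ {n} (f : Fin n → ℕ) → (∀ i → f i ≡ 1) → sum f ≡ n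
sum-one {zero}  f f≡1 = refl
sum-one {suc n} f f≡1 = cong₂ _+_ (f≡1 zero) (sum-one (f ∘ suc) (f≡1 ∘ suc))

sum-single : ∀ {n} (f : Fin n → ℕ) i → f i ≡ 1 → (∀ j → j ≢ i → f j ≡ 0) → sum f ≡ 1
sum-single f zero    fi≡1 f≡0 = cong₂ _+_ fi≡1 (sum-zero (f ∘ suc) λ j → f≡0 (suc j) λ ())
sum-single f (suc i) fi≡1 f≡0 =
  cong₂ _+_ (f≡0 zero λ ()) (sum-single (f ∘ suc) i fi≡1 λ j j≢i → f≡0 (suc j) (j≢i ∘ Fin.suc-injective))

-- The spider: distances and the tree property.

module Spider (n₀ k : ℕ) (2≤k : 2 ≤ k) where

  n : ℕ
  n = suc n₀

  instance
    k≢0 : NonZero k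
    k≢0 = >-nonZero (<-trans z<s 2≤k)

  -- Truncated subtraction makes 0 the parent of 1, ..., k. The conjunct `i < j` keeps 0 from being
  -- its own parent.
  IsParent : ℕ → ℕ → Set
  IsParent i j = i < j × i ≡ j ∸ k

  isParent? : ∀ i j → Dec (IsParent i j)
  isParent? i j = i <? j ×-dec i ≟ j ∸ k

  -- Vertex 0 is the root and the parent of j is j ∸ k, so that the legs are the residue classes
  -- mod k of the positive numbers shifted by one. The root gets the label k, which is no leg.
  height leg : ℕ → ℕ
  height zero    = 0
  height (suc i) = suc (i / k)
  leg zero    = k
  leg (suc i) = i % k

  ht lg : Fin n → ℕ
  ht v = height (toℕ v)
  lg v = leg (toℕ v)

  spider : Graph n
  spider = record
    { adj    = adjacent
    ; sym    = λ u v → ∨-comm ⌊ isParent? (toℕ u) (toℕ v) ⌋ _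
    ; irrefl = irreflexive
    }
    where
    adjacent : Fin n → Fin n → Bool
    adjacent u v = ⌊ isParent? (toℕ u) (toℕ v) ⌋ ∨ ⌊ isParent? (toℕ v) (toℕ u) ⌋
    irreflexive : ∀ v → adjacent v v ≡ false
    irreflexive v with isParent? (toℕ v) (toℕ v)
    ... | yes (v<v , _) = contradiction v<v (<-irrefl refl)
    ... | no  _         = refl

  adj⁻ : ∀ u v → T (adj spider u v) → IsParent (toℕ u) (toℕ v) ⊎ IsParent (toℕ v) (toℕ u)
  adj⁻ u v a with Equivalence.to (T-∨ {⌊ isParent? (toℕ u) (toℕ v) ⌋}) a
  ... | inj₁ p = inj₁ (toWitness p)
  ... | inj₂ p = inj₂ (toWitness p)

  adj⁺ˡ : ∀ u v → IsParent (toℕ u) (toℕ v) → T (adj spider u v)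
  adj⁺ˡ u v p = Equivalence.from (T-∨ {⌊ isParent? (toℕ u) (toℕ v) ⌋}) (inj₁ (fromWitness p))

  adj⁺ʳ : ∀ u v → IsParent (toℕ v) (toℕ u) → T (adj spider u v)
  adj⁺ʳ u v p = Equivalence.from (T-∨ {⌊ isParent? (toℕ u) (toℕ v) ⌋}) (inj₂ (fromWitness p))

  parent-height : ∀ {i j} → IsParent i j → height j ≡ suc (height i)
  parent-height {j = suc j} (_ , refl) with j <? k
  ... | yes j<k rewrite m≤n⇒m∸n≡0 j<k = cong suc (m<n⇒m/n≡0 j<k)
  ... | no  j≮k rewrite +-∸-assoc 1 (≮⇒≥ j≮k) = cong suc (m/n≡1+[m∸n]/n (≮⇒≥ j≮k))

  parent-leg : ∀ {i j} → IsParent i j → i ≡ 0 ⊎ leg i ≡ leg j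
  parent-leg {j = suc j} (_ , refl) with j <? k
  ... | yes j<k = inj₁ (m≤n⇒m∸n≡0 j<k)
  ... | no  j≮k rewrite +-∸-assoc 1 (≮⇒≥ j≮k) = inj₂ (m≤n⇒[n∸m]%m≡n%m (≮⇒≥ j≮k))

  isParent-∸ : ∀ {j} → 0 < j → IsParent (j ∸ k) j
  isParent-∸ {suc j} _ = m∸n<m k (<-trans z<s 2≤k) , refl
    where
    m∸n<m : ∀ m → 0 < m → suc j ∸ m < suc j
    m∸n<m (suc m) _ = s≤s (m∸n≤m j m)

  parent : Fin n → Fin n
  parent v = fromℕ< (≤-<-trans (m∸n≤m (toℕ v) k) (toℕ<n v))

  isParent-parent : ∀ v → 0 < toℕ v → IsParent (toℕ (parent v)) (toℕ v)
  isParent-parent v 0<v = subst (λ i → IsParent i (toℕ v)) (sym (toℕ-fromℕ< _)) (isParent-∸ 0<v)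

  height≡0⇒root : ∀ {i} → height i ≡ 0 → i ≡ 0
  height≡0⇒root {zero} _ = refl

  ht≡0⇒root : ∀ v → ht v ≡ 0 → v ≡ zero
  ht≡0⇒root v h≡0 = toℕ-injective (height≡0⇒root h≡0)

  private
    positive : ∀ v {h} → ht v ≡ suc h → 0 < toℕ v
    positive v eq with toℕ v
    ... | suc _ = z<s

  reach-root : ∀ h {j u} v → ht v ≡ h → T (reach spider j u v) → T (reach spider (h + j) u zero)
  reach-root zero    {j} {u} v eq r = subst (λ w → T (reach spider j u w)) (ht≡0⇒root v eq) r
  reach-root (suc h) {j} {u} v eq r = subst (λ i → T (reach spider i u zero)) (+-suc h j)
    (reach-root h (parent v) (suc-injective (trans (sym (parent-height p)) eq))
      (reach-adj spider j r (adj⁺ʳ v (parent v) p)))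
    where p = isParent-parent v (positive v eq)

  reach-from-root : ∀ h {j u} v → ht v ≡ h → T (reach spider j u zero) → T (reach spider (h + j) u v)
  reach-from-root zero    {j} {u} v eq r = subst (λ w → T (reach spider j u w)) (sym (ht≡0⇒root v eq)) r
  reach-from-root (suc h) {j} v eq r =
    reach-adj spider (h + j) (reach-from-root h (parent v) (suc-injective (trans (sym (parent-height p)) eq)) r)
      (adj⁺ˡ (parent v) v p)
    where p = isParent-parent v (positive v eq)

  reach-via-root : ∀ u v → T (reach spider (ht u + ht v) u v)
  reach-via-root u v = subst (λ i → T (reach spider i u v))
    (trans (cong (ht v +_) (+-identityʳ (ht u))) (+-comm (ht v) (ht u)))
    (reach-from-root (ht v) v refl (reach-root (ht u) u refl (fromWitness refl)))

  -- With at least two legs, heights are at most n / 2. Hence walks through the root have length at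
  -- most n, the range searched by `dist`.
  2*ht≤n : ∀ v → ht v * 2 ≤ n
  2*ht≤n v with toℕ v | toℕ<n v
  ... | zero  | _     = z≤n
  ... | suc i | 1+i<n = ≤-trans (s≤s (s≤s (≤-trans (*-monoʳ-≤ (i / k) 2≤k) (m/n*n≤m i k)))) 1+i<n

  ht+ht≤n : ∀ u v → ht u + ht v ≤ n
  ht+ht≤n u v = *-cancelʳ-≤ (ht u + ht v) n 2 (begin
    (ht u + ht v) * 2     ≡⟨ *-distribʳ-+ 2 (ht u) (ht v) ⟩
    ht u * 2 + ht v * 2   ≤⟨ +-mono-≤ (2*ht≤n u) (2*ht≤n v) ⟩
    n + n                 ≡⟨ cong (n +_) (+-identityʳ n) ⟨
    2 * n                 ≡⟨ *-comm 2 n ⟩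
    n * 2                 ∎)
    where open ≤-Reasoning

  ht≤reach+ht : ∀ j u w → T (reach spider j u w) → ht u ≤ j + ht w
  ht≤reach+ht zero u w r = ≤-reflexive (cong ht (toWitness r))
  ht≤reach+ht (suc j) u w r with reach-split spider j r
  ... | inj₁ r′ = m≤n⇒m≤1+n (ht≤reach+ht j u w r′)
  ... | inj₂ (x , r′ , a) with adj⁻ x w a
  ...   | inj₁ p = ≤-trans (ht≤reach+ht j u x r′)
    (m≤n⇒m≤1+n (+-monoʳ-≤ j (≤-trans (n≤1+n _) (≤-reflexive (sym (parent-height p))))))
  ...   | inj₂ p = ≤-trans (ht≤reach+ht j u x r′)
    (≤-reflexive (trans (cong (j +_) (parent-height p)) (+-suc j _)))

  module _ {ℓ : ℕ} (ℓ<k : ℓ < k) where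

    -- A walk can enter a leg only through the root. Induction on the last edge: if it leaves the
    -- root, `ht≤reach+ht` bounds the walk before it; otherwise its start is already on the leg.
    ht+ht≤reach : ∀ j u w → lg u ≢ ℓ → lg w ≡ ℓ → T (reach spider j u w) → ht u + ht w ≤ j
    ht+ht≤reach zero u w u≢ℓ w≡ℓ r = contradiction (trans (cong lg (toWitness r)) w≡ℓ) u≢ℓ
    ht+ht≤reach (suc j) u w u≢ℓ w≡ℓ r with reach-split spider j r
    ... | inj₁ r′ = m≤n⇒m≤1+n (ht+ht≤reach j u w u≢ℓ w≡ℓ r′)
    ... | inj₂ (x , r′ , a) with adj⁻ x w a
    ...   | inj₁ p rewrite parent-height p | +-suc (ht u) (ht x) with parent-leg p
    ...     | inj₁ x≡0 rewrite x≡0 | +-identityʳ (ht u) =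
      s≤s (≤-trans (ht≤reach+ht j u x r′)
        (≤-reflexive (trans (cong ((j +_) ∘ height) x≡0) (+-identityʳ j))))
    ...     | inj₂ x≡w = s≤s (ht+ht≤reach j u x u≢ℓ (trans x≡w w≡ℓ) r′)
    ht+ht≤reach (suc j) u w u≢ℓ w≡ℓ r | inj₂ (x , r′ , a) | inj₂ p with parent-leg p
    ... | inj₁ w≡0 = contradiction (trans (sym w≡ℓ) (cong leg w≡0)) (<⇒≢ ℓ<k)
    ... | inj₂ w≡x = m≤n⇒m≤1+n
      (≤-trans (+-monoʳ-≤ (ht u) (≤-trans (n≤1+n _) (≤-reflexive (sym (parent-height p)))))
        (ht+ht≤reach j u x u≢ℓ (trans (sym w≡x) w≡ℓ) r′))

    dist-off-leg : ∀ u w → lg u ≢ ℓ → lg w ≡ ℓ ⊎ toℕ w ≡ 0 → dist spider u w ≡ ht u + ht w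
    dist-off-leg u w u≢ℓ w∈ℓ =
      dist-least spider u w (reach-via-root u w) (least w∈ℓ) (ht+ht≤n u w)
      where
      least : lg w ≡ ℓ ⊎ toℕ w ≡ 0 → ∀ j → T (reach spider j u w) → ht u + ht w ≤ j
      least (inj₁ w≡ℓ) j r = ht+ht≤reach j u w u≢ℓ w≡ℓ r
      least (inj₂ w≡0) j r rewrite w≡0 = ≤-trans (≤-reflexive (+-identityʳ (ht u)))
        (≤-trans (ht≤reach+ht j u w r) (≤-reflexive (trans (cong ((j +_) ∘ height) w≡0) (+-identityʳ j))))

  connected : Connected spider
  connected u v = reach-mono spider (≤⇒≤′ (ht+ht≤n u v)) (reach-via-root u v)

  lower-adj : ∀ u v → ⌊ u Fin.<? v ⌋ ∧ adj spider u v ≡ ⌊ isParent? (toℕ u) (toℕ v) ⌋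
  lower-adj u v with isParent? (toℕ u) (toℕ v)
  ... | yes (u<v , _) rewrite T-≡ .Equivalence.to (fromWitness {a? = u Fin.<? v} u<v) = refl
  ... | no  _ with isParent? (toℕ v) (toℕ u)
  ...   | no  _ = ∧-zeroʳ _
  ...   | yes (v<u , _) with u Fin.<? v
  ...     | yes u<v = contradiction u<v (<-asym v<u)
  ...     | no  _   = refl

  sum-parents : ∀ (v : Fin n₀) → sum (λ (u : Fin n) → bit→ℕ ⌊ isParent? (toℕ u) (toℕ (suc v)) ⌋) ≡ 1
  sum-parents v = sum-single _ (parent (suc v)) is not
    where
    is : bit→ℕ ⌊ isParent? (toℕ (parent (suc v))) (toℕ (suc v)) ⌋ ≡ 1
    is with isParent? (toℕ (parent (suc v))) (toℕ (suc v))
    ... | yes _ = refl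
    ... | no ¬p = contradiction (isParent-parent (suc v) z<s) ¬p
    not : ∀ u → u ≢ parent (suc v) → bit→ℕ ⌊ isParent? (toℕ u) (toℕ (suc v)) ⌋ ≡ 0
    not u u≢p with isParent? (toℕ u) (toℕ (suc v))
    ... | yes (_ , u≡) = contradiction (toℕ-injective (trans u≡ (sym (toℕ-fromℕ< _)))) u≢p
    ... | no _ = refl

  -- After exchanging the sums, each edge is counted at its upper end in the numbering: the root
  -- contributes nothing, every other vertex its one parent.
  edgeCount-spider : edgeCount spider ≡ n₀
  edgeCount-spider = begin
    edgeCount spider
      ≡⟨ edgeCount≡∑ spider ⟩
    sum (λ u → sum (λ v → bit→ℕ (⌊ u Fin.<? v ⌋ ∧ adj spider u v)))
      ≡⟨ sum-cong-≗ (λ u → sum-cong-≗ (λ v → cong bit→ℕ (lower-adj u v))) ⟩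
    sum (λ u → sum (λ v → parents u v))
      ≡⟨ ∑-comm parents ⟩
    sum (λ v → sum (λ u → parents u v))
      ≡⟨ cong₂ _+_ (sum-zero (λ u → parents u zero) (λ _ → refl)) (sum-one _ sum-parents) ⟩
    n₀                                                                    ∎
    where
    open ≡-Reasoning
    parents : Fin n → Fin n → ℕ
    parents u v = bit→ℕ ⌊ isParent? (toℕ u) (toℕ v) ⌋

  isTree : IsTree spider
  isTree = connected , trans (cong (_+ 1) edgeCount-spider) (+-comm n₀ 1)

-- Pigeonhole, and extending candidates by one step.

missed-value : ∀ {r k} (g : Fin r → ℕ) → r < k → ∃ λ ℓ → ℓ < k × (∀ j → g j ≢ ℓ)
missed-value {r} {k} g r<k with ¬∀⟶∃¬ k Hit hit? not-all-hit
  where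
  Hit : Fin k → Set
  Hit ℓ = ∃ λ j → g j ≡ toℕ ℓ
  hit? : ∀ ℓ → Dec (Hit ℓ)
  hit? ℓ = any? λ j → g j ≟ toℕ ℓ
  not-all-hit : ¬ (∀ ℓ → Hit ℓ)
  not-all-hit hit with i , j , i<j , eq ← pigeonhole r<k (proj₁ ∘ hit) =
    <⇒≢ i<j (trans (sym (proj₂ (hit i))) (trans (cong g eq) (proj₂ (hit j))))
... | ℓ , ¬hit = toℕ ℓ , toℕ<n ℓ , λ j eq → ¬hit (j , eq)

module _ {n : ℕ} (G : Graph n) (S : CatStrategy n) (m : ℕ → Fin n) where
  open Game G S m

  mouse∈M : ValidMouse G m → ∀ t → M t (m t)
  mouse∈M valid t = m , refl , (λ j _ → valid j) , (λ j _ → ≤⇒≤ᵇ , ≤ᵇ⇒≤ _ _)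

  M-zero : ∀ v → M 0 v
  M-zero v = (λ _ → v) , refl , (λ _ ()) , (λ _ ())

  M-suc : ∀ t {v w} → ClosedNbr G v w →
          dist G (cat (suc t)) w ≤ dist G (cat t) v ⇔ T (bit (suc t)) →
          M t v → M (suc t) w
  M-suc t {v} {w} v~w consistent (m′ , m′t≡v , nbr , bits) =
    m″ , new , (λ j 1+j≤1+t → nbr″ j (s≤s⁻¹ 1+j≤1+t)) , (λ j 1+j≤1+t → bits″ j (s≤s⁻¹ 1+j≤1+t))
    where
    -- Membership in `M (suc t)` constrains trajectories only up to time t + 1, so w may serve as
    -- the value ever after.
    m″ : ℕ → Fin n
    m″ j with j ≤? t
    ... | yes _ = m′ j
    ... | no  _ = w

    old : ∀ {j} → j ≤ t → m″ j ≡ m′ j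
    old {j} j≤t with j ≤? t
    ... | yes _   = refl
    ... | no  j≰t = contradiction j≤t j≰t

    new : m″ (suc t) ≡ w
    new with suc t ≤? t
    ... | yes 1+t≤t = contradiction 1+t≤t (n≮n t)
    ... | no  _     = refl

    nbr″ : ∀ j → j ≤ t → ClosedNbr G (m″ j) (m″ (suc j))
    nbr″ j j≤t with m≤n⇒m<n∨m≡n j≤t
    ... | inj₁ j<t  = subst₂ (ClosedNbr G) (sym (old j≤t)) (sym (old j<t)) (nbr j j<t)
    ... | inj₂ refl = subst₂ (ClosedNbr G) (sym (trans (old j≤t) m′t≡v)) (sym new) v~w

    Consistent : ℕ → Fin n → Fin n → Set
    Consistent j x y = (dist G (cat (suc j)) y ≤ dist G (cat j) x → T (bit (suc j)))
                     × (T (bit (suc j)) → dist G (cat (suc j)) y ≤ dist G (cat j) x)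

    bits″ : ∀ j → j ≤ t → Consistent j (m″ j) (m″ (suc j))
    bits″ j j≤t with m≤n⇒m<n∨m≡n j≤t
    ... | inj₁ j<t  = subst₂ (Consistent j) (sym (old j≤t)) (sym (old j<t)) (bits j j<t)
    ... | inj₂ refl = subst₂ (Consistent j) (sym (trans (old j≤t) m′t≡v)) (sym new)
                        (Equivalence.to consistent , Equivalence.from consistent)

-- Rounds of mouse and ghost, in terms of heights.

data State : Set where
  home out far : State

-- x and y are the heights of two consecutive tests.
data Step (x y : ℕ) : State → State → Set where
  stay   : y ≢ x     → Step x y home home
  leave  : y ≡ x     → Step x y home out
  return : y ≢ suc x → Step x y out home
  linger : y ≡ suc x → Step x y out far
  back   : Step x y far home

next : ∀ x y s → ∃ (Step x y s)
next x y home with y ≟ x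
... | yes y≡x = out , leave y≡x
... | no  y≢x = home , stay y≢x
next x y out with y ≟ suc x
... | yes y≡1+x = far , linger y≡1+x
... | no  y≢1+x = home , return y≢1+x
next x y far = home , back

-- `home` is between rounds, `out` is one step into a round and `far` two steps.
mouseHeight : State → ℕ
mouseHeight home = 0
mouseHeight out  = 1
mouseHeight far  = 1

-- b is the height of the ghost at the start of the current round.
ghostHeight : State → ℕ → ℕ
ghostHeight home b = b
ghostHeight out  b = suc b
ghostHeight far  b = suc (suc b)

-- How long a leg must have been untested for the ghost on it to have reached `ghostHeight s b`:
-- b complete rounds of at most three steps, and the steps made in the current round.
quiet : State → ℕ → ℕ
quiet home b = b * 3
quiet out  b = suc (b * 3)
quiet far  b = suc (suc (b * 3))

shift-⇔ : ∀ y x a′ a b → y + (a′ + b) ≤ x + (a + b) ⇔ y + a′ ≤ x + a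
shift-⇔ y x a′ a b rewrite sym (+-assoc y a′ b) | sym (+-assoc x a b) =
  mk⇔ (+-cancelʳ-≤ b (y + a′) (x + a)) (+-monoˡ-≤ b)

SameAnswer : ℕ → ℕ → State → State → ℕ → ℕ → Set
SameAnswer x y s s′ h h′ = y + h′ ≤ x + h ⇔ y + mouseHeight s′ ≤ x + mouseHeight s

-- For y ≠ x, the conditions y + 1 ≤ x and y ≤ x agree.
stay-same : ∀ {x y} → y ≢ x → ∀ b → SameAnswer x y home home b (suc b)
stay-same {x} {y} y≢x b = ⇔-trans (shift-⇔ y x 1 0 b) (mk⇔
  (≤-trans (+-monoʳ-≤ y z≤n))
  (λ y≤x → ≤-trans (≤-reflexive (trans (+-suc y 0) (cong suc (+-identityʳ y))))
    (≤-trans (≤∧≢⇒< (subst₂ _≤_ (+-identityʳ y) (+-identityʳ x) y≤x) y≢x) (m≤m+n x 0))))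

-- The ghost compares y ≤ x, the mouse y ≤ x + 1; these differ only at y = x + 1.
return-same : ∀ {x y} → y ≢ suc x → ∀ b → SameAnswer x y out home (suc b) (suc b)
return-same {x} {y} y≢1+x b = ⇔-trans (shift-⇔ y x 0 0 (suc b)) (mk⇔
  (λ y≤x → ≤-trans y≤x (+-monoʳ-≤ x z≤n))
  (λ y≤1+x → ≤-trans (s≤s⁻¹ (≤∧≢⇒< (subst₂ _≤_ refl (+-comm x 1) y≤1+x) (y≢1+x ∘ trans (sym (+-identityʳ y)))))
    (m≤m+n x 0)))

-- Here both answers are negative.
linger-same : ∀ {x y} → y ≡ suc x → ∀ b → SameAnswer x y out far (suc b) (suc (suc b))
linger-same {x} refl b = ⇔-trans (shift-⇔ (suc x) x 1 0 (suc b)) (mk⇔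
  (λ le → contradiction (≤-trans le (+-monoʳ-≤ x z≤n)) (n≮n (x + 1)))
  (λ le → contradiction le (n≮n (x + 1))))

-- The game on the spider.

module Hunt (n₀ k : ℕ) (2<k : 2 < k) (H : ℕ) (room : k * (2 + H) ≤ n₀) where

  open Spider n₀ k (<⇒≤ 2<k)

  position : ℕ → ℕ → ℕ
  position ℓ zero    = 0
  position ℓ (suc h) = suc (ℓ + h * k)

  vertex : ℕ → ℕ → Fin n
  vertex ℓ h = position ℓ h mod n

  module _ {ℓ : ℕ} (ℓ<k : ℓ < k) where

    -- By `room` the legs reach height H + 2, since a ghost starting a round at height H may climb
    -- two further. So reduction mod n changes nothing here.
    toℕ-vertex : ∀ {h} → h ≤ 2 + H → toℕ (vertex ℓ h) ≡ position ℓ h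
    toℕ-vertex {h} h≤ = trans (toℕ-fromℕ< _) (m<n⇒m%n≡m (s≤s (begin
      position ℓ h   ≤⟨ bound h ⟩
      h * k          ≤⟨ *-monoˡ-≤ k h≤ ⟩
      (2 + H) * k    ≡⟨ *-comm (2 + H) k ⟩
      k * (2 + H)    ≤⟨ room ⟩
      n₀             ∎)))
      where
      open ≤-Reasoning
      bound : ∀ h → position ℓ h ≤ h * k
      bound zero    = z≤n
      bound (suc h) = +-monoˡ-≤ (h * k) ℓ<k

    height-position : ∀ h → height (position ℓ h) ≡ h
    height-position zero    = refl
    height-position (suc h) = cong suc
      (trans (+-distrib-/-∣ʳ ℓ (divides-refl h)) (cong₂ _+_ (m<n⇒m/n≡0 ℓ<k) (m*n/n≡m h k)))

    ht-vertex : ∀ {h} → h ≤ 2 + H → ht (vertex ℓ h) ≡ h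
    ht-vertex {h} h≤ = trans (cong height (toℕ-vertex h≤)) (height-position h)

    leg-position : ∀ h → leg (position ℓ (suc h)) ≡ ℓ
    leg-position h = trans ([m+kn]%n≡m%n ℓ h k) (m<n⇒m%n≡m ℓ<k)

    vertex-on-leg : ∀ {h} → h ≤ 2 + H → lg (vertex ℓ h) ≡ ℓ ⊎ toℕ (vertex ℓ h) ≡ 0
    vertex-on-leg {zero}  h≤ = inj₂ (toℕ-vertex h≤)
    vertex-on-leg {suc h} h≤ = inj₁ (trans (cong leg (toℕ-vertex h≤)) (leg-position h))

    dist-vertex : ∀ {h} u → lg u ≢ ℓ → h ≤ 2 + H → dist spider u (vertex ℓ h) ≡ ht u + h
    dist-vertex u u≢ℓ h≤ =
      trans (dist-off-leg ℓ<k u _ u≢ℓ (vertex-on-leg h≤)) (cong (ht u +_) (ht-vertex h≤))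

    isParent-position : ∀ h → IsParent (position ℓ h) (position ℓ (suc h))
    isParent-position zero    =
      z<s , sym (trans (cong (λ i → suc i ∸ k) (+-identityʳ ℓ)) (m≤n⇒m∸n≡0 ℓ<k))
    isParent-position (suc h) =
        s<s (+-monoʳ-< ℓ (m<n+m (h * k) (<-trans z<s 2<k)))
      , sym (trans (cong (λ i → suc i ∸ k) (trans (cong (ℓ +_) (+-comm k (h * k))) (sym (+-assoc ℓ (h * k) k))))
          (m+n∸n≡m (suc (ℓ + h * k)) k))

    isParent-vertex : ∀ {h} → suc h ≤ 2 + H → IsParent (toℕ (vertex ℓ h)) (toℕ (vertex ℓ (suc h)))
    isParent-vertex {h} h< =
      subst₂ IsParent (sym (toℕ-vertex (<⇒≤ h<))) (sym (toℕ-vertex h<)) (isParent-position h)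

    up-edge : ∀ {h} → suc h ≤ 2 + H → ClosedNbr spider (vertex ℓ h) (vertex ℓ (suc h))
    up-edge h< = inj₂ (adj⁺ˡ _ _ (isParent-vertex h<))

    down-edge : ∀ {h} → suc h ≤ 2 + H → ClosedNbr spider (vertex ℓ (suc h)) (vertex ℓ h)
    down-edge h< = inj₂ (adj⁺ʳ _ _ (isParent-vertex h<))

  module Play (S : CatStrategy n) where

    -- The course of the game, computed from the states alone. It coincides with `cat`, `hist` and
    -- `bit` for the mouse defined below, whose position cannot enter here because it depends on
    -- the next test.
    mutual
      tester : ℕ → Fin n
      tester zero          = c₁ S
      tester (suc zero)    = c₂ S
      tester (suc (suc t)) = f S (answers (suc t))

      answers : ℕ → List Bool
      answers zero    = []
      answers (suc t) = answers t ++ [ answer (suc t) ]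

      answer : ℕ → Bool
      answer zero    = true
      answer (suc t) =
        ht (tester (suc t)) + mouseHeight (state (suc t)) ≤ᵇ ht (tester t) + mouseHeight (state t)

      state : ℕ → State
      state zero    = home
      state (suc t) = proj₁ (next (ht (tester t)) (ht (tester (suc t))) (state t))

    step : ∀ t → Step (ht (tester t)) (ht (tester (suc t))) (state t) (state (suc t))
    step t = proj₂ (next (ht (tester t)) (ht (tester (suc t))) (state t))

    -- The mouse may sit on its leg at times t and t + 1, so both tests must miss it. The test at
    -- time t + 1 is known in advance: the answers up to time t depend on states, not on the leg
    -- chosen.
    untested : ∀ t → ∃ λ ℓ → ℓ < k × (∀ (j : Fin 2) → lg (tester (toℕ j + t)) ≢ ℓ)
    untested t = missed-value (λ j → lg (tester (toℕ j + t))) 2<k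

    refuge : ℕ → ℕ
    refuge t = proj₁ (untested t)

    refuge<k : ∀ t → refuge t < k
    refuge<k t = proj₁ (proj₂ (untested t))

    place : ℕ → State → Fin n
    place t home = zero
    place t out  = vertex (refuge t) 1
    -- `far` is entered only from `out`, so the mouse keeps the leg chosen one step earlier.
    place t far  = vertex (refuge (pred t)) 1

    mouse : ℕ → Fin n
    mouse t = place t (state t)

    dist-zero : ∀ u → dist spider u zero ≡ ht u + 0
    dist-zero u with ℓ , ℓ<k , u≢ℓ ← missed-value {1} (λ _ → lg u) (<-trans (s≤s z<s) 2<k) =
      dist-off-leg ℓ<k u zero (u≢ℓ zero) (inj₂ refl)

    dist-mouse : ∀ t → dist spider (tester t) (mouse t) ≡ ht (tester t) + mouseHeight (state t)
    dist-mouse zero = dist-zero (tester 0)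
    dist-mouse (suc t) with state (suc t)
    ... | home = dist-zero (tester (suc t))
    ... | out  = dist-vertex (refuge<k (suc t)) _ (proj₂ (proj₂ (untested (suc t))) zero) (s≤s z≤n)
    ... | far  = dist-vertex (refuge<k t) _ (proj₂ (proj₂ (untested t)) (suc zero)) (s≤s z≤n)

    place-valid : ∀ t {x y s s′} → Step x y s s′ → ClosedNbr spider (place t s) (place (suc t) s′)
    place-valid t (stay _)   = inj₁ refl
    place-valid t (leave _)  = up-edge (refuge<k (suc t)) (s≤s z≤n)
    place-valid t (return _) = down-edge (refuge<k t) (s≤s z≤n)
    place-valid t (linger _) = inj₁ refl
    place-valid t back       = down-edge (refuge<k (pred t)) (s≤s z≤n)

    mouse-valid : ValidMouse spider mouse
    mouse-valid t = place-valid t (step t)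

    open Game spider S mouse

    mutual
      cat≡tester : ∀ t → cat t ≡ tester t
      cat≡tester zero          = refl
      cat≡tester (suc zero)    = refl
      cat≡tester (suc (suc t)) = cong (f S) (hist≡answers (suc t))

      hist≡answers : ∀ t → hist t ≡ answers t
      hist≡answers zero    = refl
      hist≡answers (suc t) = cong₂ (λ bs b → bs ++ [ b ]) (hist≡answers t) (bit≡answer (suc t))

      bit≡answer : ∀ t → bit t ≡ answer t
      bit≡answer zero    = refl
      bit≡answer (suc t) = cong₂ _≤ᵇ_
        (trans (cong (λ c → dist spider c (mouse (suc t))) (cat≡tester (suc t))) (dist-mouse (suc t)))
        (trans (cong (λ c → dist spider c (mouse t)) (cat≡tester t)) (dist-mouse t))

    -- For j > t the truncated t ∸ j only repeats the test at time 0.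
    Clear : ℕ → ℕ → ℕ → Set
    Clear ℓ t r = ∀ j → j ≤ r → lg (tester (t ∸ j)) ≢ ℓ

    Clear-≤ : ∀ {ℓ t r r′} → r ≤ r′ → Clear ℓ t r′ → Clear ℓ t r
    Clear-≤ r≤r′ clear j j≤r = clear j (≤-trans j≤r r≤r′)

    Clear-pred : ∀ {ℓ t r} → Clear ℓ (suc t) (suc r) → Clear ℓ t r
    Clear-pred clear j j≤r = clear (suc j) (s≤s j≤r)

    module _ {ℓ : ℕ} (ℓ<k : ℓ < k) where

      ghost-move : ∀ t {s s′ h h′} → state t ≡ s → state (suc t) ≡ s′ →
        Clear ℓ (suc t) 1 → h ≤ 2 + H → h′ ≤ 2 + H →
        ClosedNbr spider (vertex ℓ h) (vertex ℓ h′) →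
        SameAnswer (ht (tester t)) (ht (tester (suc t))) s s′ h h′ →
        M t (vertex ℓ h) → M (suc t) (vertex ℓ h′)
      ghost-move t {h = h} {h′} refl refl clear h≤ h′≤ h~h′ iff =
        M-suc spider S mouse t h~h′
          (subst₂ (λ p q → p ≤ q ⇔ T (bit (suc t)))
            (sym (dist-cat (suc t) (clear 0 z≤n) h′≤)) (sym (dist-cat t (clear 1 (s≤s z≤n)) h≤))
            (subst (λ b → ht (tester (suc t)) + h′ ≤ ht (tester t) + h ⇔ T b) (sym (bit≡answer (suc t)))
              (⇔-trans iff (mk⇔ ≤⇒≤ᵇ (≤ᵇ⇒≤ _ _)))))
        where
        dist-cat : ∀ t {h} → lg (tester t) ≢ ℓ → h ≤ 2 + H →
                   dist spider (cat t) (vertex ℓ h) ≡ ht (tester t) + h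
        dist-cat t {h} t≢ℓ h≤ =
          trans (cong (λ c → dist spider c (vertex ℓ h)) (cat≡tester t)) (dist-vertex ℓ<k _ t≢ℓ h≤)

      -- All b are carried at once: the ghost at b + 1 after a round continues the one at b before
      -- it.
      Haunted : ℕ → State → Set
      Haunted t s = ∀ b → b ≤ H → Clear ℓ t (quiet s b) → M t (vertex ℓ (ghostHeight s b))

      Haunted-suc : ∀ t {s s′} → state t ≡ s → state (suc t) ≡ s′ →
        Step (ht (tester t)) (ht (tester (suc t))) s s′ → Haunted t s → Haunted (suc t) s′
      -- At the end of a round the ghost with b = 0 is the mouse itself, at the root.
      Haunted-suc t e e′ (stay _) haunted zero b≤H clear =
        subst (λ s → M (suc t) (place (suc t) s)) e′ (mouse∈M spider S mouse mouse-valid (suc t))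
      Haunted-suc t e e′ (return _) haunted zero b≤H clear =
        subst (λ s → M (suc t) (place (suc t) s)) e′ (mouse∈M spider S mouse mouse-valid (suc t))
      Haunted-suc t e e′ back haunted zero b≤H clear =
        subst (λ s → M (suc t) (place (suc t) s)) e′ (mouse∈M spider S mouse mouse-valid (suc t))
      Haunted-suc t e e′ (stay y≢x) haunted (suc b) b<H clear =
        ghost-move t e e′ (Clear-≤ (s≤s z≤n) clear) (m≤n⇒m≤o+n 2 b≤H) (m≤n⇒m≤o+n 2 b<H)
          (up-edge ℓ<k (m≤n⇒m≤o+n 2 b<H)) (stay-same y≢x b)
          (haunted b b≤H (Clear-≤ (m≤n+m (b * 3) 2) (Clear-pred clear)))
        where b≤H = <⇒≤ b<H
      Haunted-suc t e e′ (leave _) haunted b b≤H clear =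
        ghost-move t e e′ (Clear-≤ (s≤s z≤n) clear) (m≤n⇒m≤o+n 2 b≤H) (s≤s (m≤n⇒m≤o+n 1 b≤H))
          (up-edge ℓ<k (s≤s (m≤n⇒m≤o+n 1 b≤H))) (shift-⇔ _ _ 1 0 b) (haunted b b≤H (Clear-pred clear))
      Haunted-suc t e e′ (return y≢1+x) haunted (suc b) b<H clear =
        ghost-move t e e′ (Clear-≤ (s≤s z≤n) clear) (m≤n⇒m≤o+n 2 b<H) (m≤n⇒m≤o+n 2 b<H)
          (inj₁ refl) (return-same y≢1+x b) (haunted b (<⇒≤ b<H) (Clear-≤ (n≤1+n _) (Clear-pred clear)))
      Haunted-suc t e e′ (linger y≡1+x) haunted b b≤H clear =
        ghost-move t e e′ (Clear-≤ (s≤s z≤n) clear) (s≤s (m≤n⇒m≤o+n 1 b≤H)) (s≤s (s≤s b≤H))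
          (up-edge ℓ<k (s≤s (s≤s b≤H)))
          (linger-same y≡1+x b)
          (haunted b b≤H (Clear-pred clear))
      Haunted-suc t e e′ back haunted (suc b) b<H clear =
        ghost-move t e e′ (Clear-≤ (s≤s z≤n) clear) (s≤s (s≤s b≤H)) (m≤n⇒m≤o+n 2 b<H)
          (down-edge ℓ<k (s≤s (s≤s b≤H))) (shift-⇔ _ _ 0 1 (suc b)) (haunted b b≤H (Clear-pred clear))
        where b≤H = <⇒≤ b<H

      haunted : ∀ t → Haunted t (state t)
      -- Before any answer every vertex is a candidate, so ghosts of all heights are present from
      -- the start.
      haunted zero    b b≤H clear = M-zero spider S mouse _
      haunted (suc t) = Haunted-suc t refl refl (step t) (haunted t)

    -- One leg for v and 3 + 3H for the tests at times t, ..., t - (2 + 3H), the longest span that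
    -- `quiet` demands at height H.
    legs-to-avoid : ℕ → Fin n → Fin (4 + H * 3) → ℕ
    legs-to-avoid t v zero    = lg v
    legs-to-avoid t v (suc j) = lg (tester (t ∸ toℕ j))

    far-ghost : 4 + H * 3 < k → ∀ t v → ∃ λ w → M t w × H ≤ dist spider v w
    far-ghost legs t v with ℓ , ℓ<k , missed ← missed-value (legs-to-avoid t v) legs =
        vertex ℓ h
      , haunted ℓ<k t H ≤-refl (λ j j≤q → missed′ j (≤-trans j≤q (quiet≤ (state t))))
      , ≤-trans (≤-trans (H≤ (state t)) (m≤n+m h (ht v)))
                (≤-reflexive (sym (dist-vertex ℓ<k v (missed zero) (h≤ (state t)))))
      where
      h = ghostHeight (state t) H
      missed′ : ∀ j → j ≤ 2 + H * 3 → lg (tester (t ∸ j)) ≢ ℓ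
      missed′ j j≤ = subst (λ i → lg (tester (t ∸ i)) ≢ ℓ) (toℕ-fromℕ< (s≤s j≤))
        (missed (suc (fromℕ< (s≤s j≤))))
      quiet≤ : ∀ s → quiet s H ≤ 2 + H * 3
      quiet≤ home = m≤n+m _ 2
      quiet≤ out  = n≤1+n _
      quiet≤ far  = ≤-refl
      H≤ : ∀ s → H ≤ ghostHeight s H
      H≤ home = ≤-refl
      H≤ out  = n≤1+n H
      H≤ far  = m≤n+m H 2
      h≤ : ∀ s → ghostHeight s H ≤ 2 + H
      h≤ home = m≤n+m H 2
      h≤ out  = n≤1+n _
      h≤ far  = ≤-refl

-- Choice of the parameters and conclusion.

sqrt-bracket : ∀ c m → ∃ λ g →
  suc c * (suc g * suc g) ≤ suc c + m × suc c + m < suc c * ((2 + g) * (2 + g))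
sqrt-bracket c zero = 0 , ≤-reflexive eq , subst (_< suc c * 4) eq (*-monoʳ-< (suc c) (s<s z<s))
  where
  eq : suc c * 1 ≡ suc c + 0
  eq = trans (*-identityʳ (suc c)) (sym (+-identityʳ (suc c)))
sqrt-bracket c (suc m) with sqrt-bracket c m
... | g , lo , hi with m≤n⇒m<n∨m≡n hi
...   | inj₁ hi′ = g , ≤-trans lo (+-monoʳ-≤ (suc c) (n≤1+n m)) ,
  subst (_< suc c * ((2 + g) * (2 + g))) (sym (+-suc (suc c) m)) hi′
...   | inj₂ eq = suc g , ≤-reflexive (sym eq′) ,
  subst (_< suc c * ((3 + g) * (3 + g))) (sym eq′)
    (*-monoʳ-< (suc c) (*-mono-< (n<1+n (2 + g)) (n<1+n (2 + g))))
  where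
  eq′ : suc c + suc m ≡ suc c * ((2 + g) * (2 + g))
  eq′ = trans (+-suc (suc c) m) eq

legs-fit : ∀ g {n} → 144 * (suc g * suc g) ≤ suc n → (5 + (2 + g) * 3) * (2 + (2 + g)) ≤ n
legs-fit g {n} lo = s≤s⁻¹ (begin-strict
  (11 + g * 3) * (4 + g)          ≤⟨ *-mono-≤
                                       (+-monoʳ-≤ 11 (*-monoʳ-≤ g (s≤s (s≤s (s≤s z≤n))))) (+-monoʳ-≤ 4 (m≤m*n g 4)) ⟩
  (suc g * 11) * (suc g * 4)      ≡⟨ [m*n]*[o*p]≡[m*o]*[n*p] (suc g) 11 (suc g) 4 ⟩
  suc g * suc g * 44              ≡⟨ *-comm (suc g * suc g) 44 ⟩
  44 * (suc g * suc g)            <⟨ *-monoˡ-< (suc g * suc g) (m≤m+n 45 99) ⟩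
  144 * (suc g * suc g)           ≤⟨ lo ⟩
  suc n                           ∎)
  where open ≤-Reasoning

theorem1p2 : ∃[ N ] ∀ (n : ℕ) → n ≥ N →
    Σ (Graph n) λ T → IsTree T ×
    (∀ (S : CatStrategy n) → Σ (ℕ → Fin n) λ m → ValidMouse T m ×
    (∀ t → ¬ RadAtMostSqrtOver12 T (Game.M T S m t)))
theorem1p2 = 144 , λ n n≥144 → evade n (sqrt-bracket 143 (n ∸ 144)) (m+[n∸m]≡n n≥144)
  where
  evade : ∀ n {c} → (∃ λ g → 144 * (suc g * suc g) ≤ c × c < 144 * ((2 + g) * (2 + g))) → c ≡ n →
    Σ (Graph n) λ T → IsTree T ×
    (∀ (S : CatStrategy n) → Σ (ℕ → Fin n) λ m → ValidMouse T m ×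
    (∀ t → ¬ RadAtMostSqrtOver12 T (Game.M T S m t)))
  evade (suc n₀) (g , lo , hi) refl =
      spider , isTree , λ S → Play.mouse S , Play.mouse-valid S , λ t (v , close) →
        let w , w∈M , H≤d = Play.far-ghost S ≤-refl t v
        in <⇒≱ hi (≤-trans (*-monoʳ-≤ 144 (*-mono-≤ H≤d H≤d)) (close w w∈M))
    where
    -- The least H with 144 H² > n, that is H > √n / 12. The 5 + 3H legs exceed the 4 + 3H to be
    -- avoided.
    H = 2 + g
    open Hunt n₀ (5 + H * 3) (s≤s (s≤s (s≤s z≤n))) H (legs-fit g lo)
    open Spider n₀ (5 + H * 3) (s≤s (s≤s z≤n))
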